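{- The string rewriting system $T=D_T\cup A\cup B$ is terminating if and only if the Collatz conjecture holds, i.e. if and only if for every $n\in\mathbb{N}^+$ there is $k\in\mathbb{N}$ with $C^k(n)=1$ (equivalently, every trajectory of the map $\tau(n)=n/2$ for even $n$, $\tau(n)=(3n+1)/2$ for odd $n$, on $\mathbb{N}^+$ contains $1$).
   Context: $C:\mathbb{N}^+\to\mathbb{N}^+$ is the Collatz function $C(n)=n/2$ for $n$ even, $C(n)=3n+1$ for $n$ odd; $C^k$ is the $k$-fold iterate. A string rewriting system $R$ induces $u\ell v\to_R urv$ for each rule $\ell\to r$; it is terminating if there is no infinite rewrite sequence. Alphabet $\{0_2,1_2,0_3,1_3,2_3,\lhd,\rhd\}$. $D_T=\{0_2\rhd\to\rhd,\ 1_2\rhd\to 2_3\rhd\}$; $A=\{0_20_3\to0_30_2,\ 0_21_3\to0_31_2,\ 0_22_3\to1_30_2,\ 1_20_3\to1_31_2,\ 1_21_3\to2_30_2,\ 1_22_3\to2_31_2\}$; $B=\{\lhd0_3\to\lhd1_2,\ \lhd1_3\to\lhd0_20_2,\ \lhd2_3\to\lhd0_21_2\}$. (Intended reading: a string $\lhd d_1\cdots d_k\rhd$ represents the value obtained from $1$ by applying successively $d_1,\dots,d_k$, where $a_b$ acts as $x\mapsto bx+a$.) -}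

module Defs where

open import Data.Bool.Base using (if_then_else_)
open import Data.List.Base using (List; []; _∷_; _++_)
open import Data.Nat.Base using (ℕ; suc; _+_; _*_; _/_; NonZero)
open import Data.Nat.Divisibility using (_∣?_)
open import Data.Nat.GeneralisedArithmetic using (iterate)
open import Data.Product.Base using (Σ-syntax; ∃-syntax)
open import Level using (0ℓ)
open import Relation.Binary.Construct.Union using (_∪_)
open import Relation.Binary.Core using (Rel)
open import Relation.Binary.PropositionalEquality.Core using (_≡_)
open import Relation.Nullary.Decidable.Core using (does)
open import Relation.Nullary.Negation.Core using (¬_)

-- The Collatz function and its accelerated form.  Both are total on ℕ, send
-- positive numbers to positive numbers, and are only iterated from positive
-- starting points below; their value at 0 is irrelevant.

C : ℕ → ℕ
C n = if does (2 ∣? n) then n / 2 else 3 * n + 1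

τ : ℕ → ℕ
τ n = if does (2 ∣? n) then n / 2 else (3 * n + 1) / 2

EveryTrajectoryReaches1 : (ℕ → ℕ) → Set
EveryTrajectoryReaches1 f = ∀ n → .{{_ : NonZero n}} → ∃[ k ] iterate f n k ≡ 1

CollatzConjecture : Set
CollatzConjecture = EveryTrajectoryReaches1 C

-- A string rewriting system over X is a set of rules, i.e. a binary relation
-- on strings.

SRS : Set → Set₁
SRS X = Rel (List X) 0ℓ

data Rewrite {X : Set} (R : SRS X) : Rel (List X) 0ℓ where
  rewriteAt : ∀ u {l r} v → R l r → Rewrite R (u ++ l ++ v) (u ++ r ++ v)

-- Constructively, StronglyNormalizing (Rewrite R) implies this, but the converse
-- needs classical reasoning.

Terminating : {X : Set} → SRS X → Set
Terminating {X} R =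
  ¬ (Σ[ s ∈ (ℕ → List X) ] (∀ i → Rewrite R (s i) (s (suc i))))

-- The symbol dᵦ stands for x ↦ β * x + d, except that ◁ and ▷ are the left
-- and right end markers.

data Symbol : Set where
  0₂ 1₂ 0₃ 1₃ 2₃ ◁ ▷ : Symbol

data D-T : SRS Symbol where
  0₂▷ : D-T (0₂ ∷ ▷ ∷ []) (▷ ∷ [])
  1₂▷ : D-T (1₂ ∷ ▷ ∷ []) (2₃ ∷ ▷ ∷ [])

data A : SRS Symbol where
  0₂0₃ : A (0₂ ∷ 0₃ ∷ []) (0₃ ∷ 0₂ ∷ [])
  0₂1₃ : A (0₂ ∷ 1₃ ∷ []) (0₃ ∷ 1₂ ∷ [])
  0₂2₃ : A (0₂ ∷ 2₃ ∷ []) (1₃ ∷ 0₂ ∷ [])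
  1₂0₃ : A (1₂ ∷ 0₃ ∷ []) (1₃ ∷ 1₂ ∷ [])
  1₂1₃ : A (1₂ ∷ 1₃ ∷ []) (2₃ ∷ 0₂ ∷ [])
  1₂2₃ : A (1₂ ∷ 2₃ ∷ []) (2₃ ∷ 1₂ ∷ [])

data B : SRS Symbol where
  ◁0₃ : B (◁ ∷ 0₃ ∷ []) (◁ ∷ 1₂ ∷ [])
  ◁1₃ : B (◁ ∷ 1₃ ∷ []) (◁ ∷ 0₂ ∷ 0₂ ∷ [])
  ◁2₃ : B (◁ ∷ 2₃ ∷ []) (◁ ∷ 0₂ ∷ 1₂ ∷ [])

T : SRS Symbol
T = D-T ∪ A ∪ B

{-# OPTIONS --safe #-}
-- Give ◁ the constant function 1 and let digits act on the right: the rules of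
-- A and B preserve the value of ◁ w ▷, those of D_T apply τ to it.
--
-- If T is terminating, rewrite ◁ w ▷ with w the binary expansion of n.  As long
-- as w is nonempty some rule applies, so we end in ◁ ▷, which has value 1.
--
-- Conversely, scan an arbitrary string from left to right and charge each ▷ with
-- the τ-stopping time of the value just read if a ◁ precedes it (with no ▷ in
-- between), and with the number of binary digits since the last ▷ otherwise.
-- The total charge drops under D_T and is invariant under A and B, which
-- terminate by an interpretation in strictly monotone functions.
module Submission where

open import Defs
open import Axiom.ExcludedMiddle using (ExcludedMiddle)
open import Data.Bool.Base using (true; false; if_then_else_)
open import Data.List.Base using (List; []; _∷_; _++_; _∷ʳ_; foldl)
open import Data.List.Properties using (foldl-++; foldl-∷ʳ)
open import Data.List.Relation.Unary.All using (All; []; _∷_)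
open import Data.List.Relation.Unary.All.Properties using (∷ʳ⁺)
open import Data.Nat.Base
open import Data.Nat.DivMod using (m*n/n≡m)
open import Data.Nat.Divisibility using (_∣?_; divides; m∣m*n)
open import Data.Nat.GeneralisedArithmetic using (iterate)
open import Data.Nat.Induction using (<-wellFounded)
open import Data.Nat.Properties
open import Data.Nat.Tactic.RingSolver using (solve-∀)
open import Data.Product.Base using (_×_; _,_; proj₁; proj₂; ∃-syntax; Σ-syntax)
open import Data.Product.Relation.Binary.Lex.Strict using (×-Lex; ×-wellFounded)
open import Data.Sum.Base using (_⊎_; inj₁; inj₂)
open import Function.Base using (flip; _on_; _∘_)
open import Function.Bundles using (_⇔_; mk⇔)
open import Induction.InfiniteDescent using (descent∧wf⇒empty)
open import Induction.WellFounded using (Acc; acc; module Subrelation)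
import Relation.Binary.Construct.On as On
open import Function.Properties.Equivalence using () renaming (sym to ⇔-sym; trans to ⇔-trans)
open import Level using (0ℓ)
open import Relation.Binary.Construct.Union using (_∪_)
open import Relation.Binary.PropositionalEquality
  using (_≡_; _≢_; refl; sym; trans; cong; subst; module ≡-Reasoning)
open import Relation.Binary.Rewriting using (StronglyNormalizing)
open import Relation.Nullary.Decidable using (does; yes; no; dec-true; dec-false)
open import Relation.Nullary.Negation.Core using (¬_; contradiction)
import Relation.Unary as U

-- Termination of string rewriting systems

module _ {X : Set} {R : SRS X} where

  Rewrite-∷ : ∀ c {x y} → Rewrite R x y → Rewrite R (c ∷ x) (c ∷ y)
  Rewrite-∷ c (rewriteAt u v rule) = rewriteAt (c ∷ u) v rule

  stronglyNormalizing⇒terminating : StronglyNormalizing (Rewrite R) → Terminating R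
  stronglyNormalizing⇒terminating sn (s , steps) =
    descent∧wf⇒empty {P = λ x → ∃[ i ] s i ≡ x}
      (λ { (i , refl) → s (suc i) , steps i , suc i , refl }) sn (s 0) (0 , refl)

  -- An inaccessible string has an inaccessible reduct, so an infinite sequence starts from it.
  -- Excluded middle decides the Σ-type of such reducts, so `next` returns an actual one and `play`
  -- is plain recursion.
  terminating⇒stronglyNormalizing :
    ExcludedMiddle 0ℓ → Terminating R → StronglyNormalizing (Rewrite R)
  terminating⇒stronglyNormalizing em terminating x with em {Acc (flip (Rewrite R)) x}
  ... | yes x-acc = x-acc
  ... | no ¬x-acc =
    contradiction (proj₁ ∘ play , λ i → proj₁ (proj₂ (next (play i)))) terminating
    where
    Inaccessible : Set
    Inaccessible = Σ[ y ∈ List X ] ¬ Acc (flip (Rewrite R)) y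

    next : ((y , _) : Inaccessible) → ∃[ z ] Rewrite R y z × ¬ Acc (flip (Rewrite R)) z
    next (y , ¬y-acc) with em {∃[ z ] Rewrite R y z × ¬ Acc (flip (Rewrite R)) z}
    ... | yes found = found
    ... | no ¬found = contradiction (acc λ {z} → accessible z) ¬y-acc
      where
      accessible : ∀ z → Rewrite R y z → Acc (flip (Rewrite R)) z
      accessible z y⟶z with em {Acc (flip (Rewrite R)) z}
      ... | yes z-acc = z-acc
      ... | no ¬z-acc = contradiction (z , y⟶z , ¬z-acc) ¬found

    play : ℕ → Inaccessible
    play zero    = x , ¬x-acc
    play (suc i) with next (play i)
    ... | z , _ , ¬z-acc = z , ¬z-acc

-- The Collatz functions C and τ

data Parity : ℕ → Set where
  even : ∀ m → Parity (2 * m)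
  odd  : ∀ m → Parity (1 + 2 * m)

parity? : ∀ n → Parity n
parity? zero = even 0
parity? (suc n) with parity? n
... | even m = odd m
... | odd m  = subst Parity (*-suc 2 m) (even (suc m))

2∤1+2* : ∀ m → does (2 ∣? (1 + 2 * m)) ≡ false
2∤1+2* m = dec-false (2 ∣? _) λ { (divides q eq) →
  even≢odd q m (trans (*-comm 2 q) (sym eq)) }

2*m/2≡m : ∀ m → 2 * m / 2 ≡ m
2*m/2≡m m = trans (cong (_/ 2) (*-comm 2 m)) (m*n/n≡m m 2)

3[1+2m]+1≡2[2+3m] : ∀ m → 3 * (1 + 2 * m) + 1 ≡ 2 * (2 + 3 * m)
3[1+2m]+1≡2[2+3m] = solve-∀

C-even : ∀ m → C (2 * m) ≡ m
C-even m rewrite dec-true (2 ∣? (2 * m)) (m∣m*n m) = 2*m/2≡m m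

C-odd : ∀ m → C (1 + 2 * m) ≡ 2 * (2 + 3 * m)
C-odd m rewrite 2∤1+2* m = 3[1+2m]+1≡2[2+3m] m

τ-even : ∀ m → τ (2 * m) ≡ m
τ-even m rewrite dec-true (2 ∣? (2 * m)) (m∣m*n m) = 2*m/2≡m m

τ-odd : ∀ m → τ (1 + 2 * m) ≡ 2 + 3 * m
τ-odd m rewrite 2∤1+2* m =
  trans (cong (_/ 2) (3[1+2m]+1≡2[2+3m] m)) (2*m/2≡m (2 + 3 * m))

Hits1 : (ℕ → ℕ) → ℕ → Set
Hits1 f n = ∃[ k ] iterate f n k ≡ 1

Hits1-step : ∀ {f m} n → m ≡ f n → Hits1 f m → Hits1 f n
Hits1-step n refl (k , eq) = suc k , eq

C-hits1⇒τ-hits1 : ∀ n → Hits1 C n → Hits1 τ n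
C-hits1⇒τ-hits1 = λ n (k , eq) → go (<-wellFounded k) n eq
  where
  go : ∀ {k} → Acc _<_ k → ∀ n → iterate C n k ≡ 1 → Hits1 τ n
  go {zero}  _ n eq = 0 , eq
  go {suc k} a n eq with parity? n
  go {suc k} (acc rec) _ eq | even m =
    Hits1-step (2 * m) (sym (τ-even m))
      (go (rec (n<1+n k)) m (subst (λ x → iterate C x k ≡ 1) (C-even m) eq))
  -- The value that `τ` skips is even, so the `C`-trajectory cannot first meet 1 there.
  go {suc zero} _ _ eq | odd m =
    contradiction (trans (sym (C-odd m)) eq) (even≢odd (2 + 3 * m) 0)
  go {suc (suc k)} (acc rec) _ eq | odd m =
    Hits1-step (1 + 2 * m) (sym (τ-odd m))
      (go (rec (m<n⇒m<1+n (n<1+n k))) (2 + 3 * m)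
        (subst (λ x → iterate C x k ≡ 1) (trans (cong C (C-odd m)) (C-even (2 + 3 * m))) eq))

τ-hits1⇒C-hits1 : ∀ n → Hits1 τ n → Hits1 C n
τ-hits1⇒C-hits1 n (k , eq) = go k n eq
  where
  go : ∀ k n → iterate τ n k ≡ 1 → Hits1 C n
  go zero    n eq = 0 , eq
  go (suc k) n eq with parity? n
  ... | even m =
    Hits1-step (2 * m) (sym (C-even m))
      (go k m (subst (λ x → iterate τ x k ≡ 1) (τ-even m) eq))
  ... | odd m =
    Hits1-step (1 + 2 * m) (sym (C-odd m))
      (Hits1-step (2 * (2 + 3 * m)) (sym (C-even (2 + 3 * m)))
        (go k (2 + 3 * m) (subst (λ x → iterate τ x k ≡ 1) (τ-odd m) eq)))

reaches1-map : ∀ {f g} → (∀ n → Hits1 f n → Hits1 g n) →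
               EveryTrajectoryReaches1 f → EveryTrajectoryReaches1 g
reaches1-map hits reaches n = hits n (reaches n)

collatz⇔τ-reaches1 : CollatzConjecture ⇔ EveryTrajectoryReaches1 τ
collatz⇔τ-reaches1 = mk⇔ (reaches1-map C-hits1⇒τ-hits1) (reaches1-map τ-hits1⇒C-hits1)

-- Stopping times

module _ (f : ℕ → ℕ) where

  firstHit : ℕ → ℕ → ℕ
  firstHit zero    n = 0
  firstHit (suc k) n = if n ≡ᵇ 1 then 0 else suc (firstHit k (f n))

  -- The first argument of `firstHit` is fuel. The times supplied by `reaches` need not be minimal,
  -- nor related for `n` and `f n`; any fuel that ends at 1 lets the count stop at the same first 1.
  firstHit-unique : ∀ k j n → iterate f n k ≡ 1 → iterate f n j ≡ 1 →
                    firstHit k n ≡ firstHit j n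
  firstHit-unique zero    zero    n _    _    = refl
  firstHit-unique zero    (suc j) n refl _    = refl
  firstHit-unique (suc k) zero    n _    refl = refl
  firstHit-unique (suc k) (suc j) n p    q    with n ≡ᵇ 1
  ... | true  = refl
  ... | false = cong suc (firstHit-unique k j (f n) p q)

  module _ (reaches : EveryTrajectoryReaches1 f) where

    stoppingTime : (n : ℕ) → .{{NonZero n}} → ℕ
    stoppingTime n = firstHit (proj₁ (reaches n)) n

    stoppingTime-< : ∀ m n .{{_ : NonZero m}} .{{_ : NonZero n}} →
                     f n ≡ m → n ≢ 1 → stoppingTime m < stoppingTime n
    stoppingTime-< m n refl n≢1 with reaches n
    ... | zero  , eq = contradiction eq n≢1
    ... | suc k , eq rewrite dec-false (n ≟ 1) n≢1 =
      s≤s (≤-reflexive (firstHit-unique (proj₁ (reaches m)) k m (proj₂ (reaches m)) eq))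

-- The value of a string

infixl 6 _⊙_

_⊙_ : ℕ → Symbol → ℕ
x ⊙ 0₂ = 2 * x
x ⊙ 1₂ = 1 + 2 * x
x ⊙ 0₃ = 3 * x
x ⊙ 1₃ = 1 + 3 * x
x ⊙ 2₃ = 2 + 3 * x
x ⊙ ◁  = 1
x ⊙ ▷  = x

eval : ℕ → List Symbol → ℕ
eval = foldl _⊙_

⊙-nonZero : ∀ x c .{{_ : NonZero x}} → NonZero (x ⊙ c)
⊙-nonZero x 0₂ = m*n≢0 2 x
⊙-nonZero x 1₂ = _
⊙-nonZero x 0₃ = m*n≢0 3 x
⊙-nonZero x 1₃ = _
⊙-nonZero x 2₃ = _
⊙-nonZero x ◁  = _
⊙-nonZero x ▷  = >-nonZero (>-nonZero⁻¹ x)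

-- Reading `b` in base 2 and then `t` in base 3 gives `6 * x + (3 * b + t)`; in the opposite order,
-- `t′` and `b′` are quotient and remainder of `3 * b + t` by 2.
commute : ∀ b t t′ b′ → 3 * b + t ≡ 2 * t′ + b′ →
          ∀ x → t + 3 * (b + 2 * x) ≡ b′ + 2 * (t′ + 3 * x)
commute b t t′ b′ eq x = begin
  t + 3 * (b + 2 * x)     ≡⟨ lhs b t x ⟩
  3 * b + t + 6 * x       ≡⟨ cong (_+ 6 * x) eq ⟩
  2 * t′ + b′ + 6 * x     ≡⟨ rhs b′ t′ x ⟩
  b′ + 2 * (t′ + 3 * x)   ∎
  where
  open ≡-Reasoning
  lhs : ∀ b t x → t + 3 * (b + 2 * x) ≡ 3 * b + t + 6 * x
  lhs = solve-∀
  rhs : ∀ b t x → 2 * t + b + 6 * x ≡ b + 2 * (t + 3 * x)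
  rhs = solve-∀

A-eval : ∀ {l r} → A l r → ∀ x → eval x l ≡ eval x r
A-eval 0₂0₃ = commute 0 0 0 0 refl
A-eval 0₂1₃ = commute 0 1 0 1 refl
A-eval 0₂2₃ = commute 0 2 1 0 refl
A-eval 1₂0₃ = commute 1 0 1 1 refl
A-eval 1₂1₃ = commute 1 1 2 0 refl
A-eval 1₂2₃ = commute 1 2 2 1 refl

data Binary : Symbol → Set where
  0₂ : Binary 0₂
  1₂ : Binary 1₂

data Ternary : Symbol → Set where
  0₃ : Ternary 0₃
  1₃ : Ternary 1₃
  2₃ : Ternary 2₃

Digit : Symbol → Set
Digit = Binary U.∪ Ternary

binaryExpansion : ∀ n .{{_ : NonZero n}} → ∃[ w ] All Digit w × eval 1 w ≡ n
binaryExpansion n {{n≢0}} = go (<-wellFounded n) n≢0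
  where
  open ≡-Reasoning

  append : ∀ {m d} → Digit d → ∃[ w ] All Digit w × eval 1 w ≡ m →
           ∃[ w ] All Digit w × eval 1 w ≡ m ⊙ d
  append {m} {d} d-digit (w , ds , eq) = w ∷ʳ d , ∷ʳ⁺ ds d-digit , (begin
    eval 1 (w ∷ʳ d)  ≡⟨ foldl-∷ʳ _⊙_ 1 d w ⟩
    eval 1 w ⊙ d     ≡⟨ cong (_⊙ d) eq ⟩
    m ⊙ d            ∎)

  go : ∀ {n} → Acc _<_ n → .(NonZero n) → ∃[ w ] All Digit w × eval 1 w ≡ n
  go {n} a nz with parity? n
  go (acc rec) _ | even m@(suc _) = append (inj₁ 0₂) (go (rec (m<m+n m z<s)) _)
  -- The leading binary digit 1 is contributed by `◁`.
  go (acc rec) _ | odd zero       = [] , [] , refl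
  go (acc rec) _ | odd m@(suc _)  = append (inj₁ 1₂) (go (rec (s≤s (m≤n*m m 2))) _)

-- Termination of T implies the Collatz conjecture

-- A leading ternary digit needs its left neighbour, a binary digit or `◁`, to form a redex, so this
-- case is handed to the caller. Values are compared from every `x` because `w` is a suffix with an
-- arbitrary prefix.
data Progress (w : List Symbol) : Set where
  empty   : w ≡ [] → Progress w
  ternary : ∀ {t v} → Ternary t → All Digit v → w ≡ t ∷ v → Progress w
  reduces : ∀ {w′} → All Digit w′ → Rewrite T (w ∷ʳ ▷) (w′ ∷ʳ ▷) →
            (∀ x → eval x w′ ≡ eval x w ⊎ eval x w′ ≡ τ (eval x w)) → Progress w

swap : ∀ {b t} → Binary b → Ternary t →
       ∃[ t′ ] ∃[ b′ ] Ternary t′ × Binary b′ × A (b ∷ t ∷ []) (t′ ∷ b′ ∷ [])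
swap 0₂ 0₃ = _ , _ , 0₃ , 0₂ , 0₂0₃
swap 0₂ 1₃ = _ , _ , 0₃ , 1₂ , 0₂1₃
swap 0₂ 2₃ = _ , _ , 1₃ , 0₂ , 0₂2₃
swap 1₂ 0₃ = _ , _ , 1₃ , 1₂ , 1₂0₃
swap 1₂ 1₃ = _ , _ , 2₃ , 0₂ , 1₂1₃
swap 1₂ 2₃ = _ , _ , 2₃ , 1₂ , 1₂2₃

progress : ∀ {w} → All Digit w → Progress w
progress []             = empty refl
progress (inj₂ t ∷ ds) = ternary t ds refl
progress (inj₁ b ∷ ds) with progress ds
progress (inj₁ 0₂ ∷ ds) | empty refl =
  reduces [] (rewriteAt [] [] (inj₁ 0₂▷)) (λ x → inj₂ (sym (τ-even x)))
progress (inj₁ 1₂ ∷ ds) | empty refl =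
  reduces (inj₂ 2₃ ∷ []) (rewriteAt [] [] (inj₁ 1₂▷)) (λ x → inj₂ (sym (τ-odd x)))
progress (inj₁ b ∷ ds) | ternary {v = v} t es refl with swap b t
... | t′ , b′ , t′-ternary , b′-binary , rule =
  reduces (inj₂ t′-ternary ∷ inj₁ b′-binary ∷ es)
    (rewriteAt [] (v ∷ʳ ▷) (inj₂ (inj₁ rule)))
    (λ x → inj₁ (cong (λ y → eval y v) (sym (A-eval rule x))))
progress (_∷_ {x = b} (inj₁ b-binary) ds) | reduces es step value =
  reduces (inj₁ b-binary ∷ es) (Rewrite-∷ b step) (λ x → value (x ⊙ b))

⟨_⟩ : List Symbol → List Symbol
⟨ w ⟩ = ◁ ∷ w ∷ʳ ▷

accessible⇒τ-hits1 : ∀ {w} → Acc (flip (Rewrite T)) ⟨ w ⟩ → All Digit w → Hits1 τ (eval 1 w)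
accessible⇒τ-hits1 (acc rec) ds with progress ds
... | empty refl = 0 , refl
-- Read from 1, the two sides of each B rule compute to the same number (3, 4 or 5), so the
-- recursive result has the required type.
... | ternary {v = v} 0₃ es refl =
  accessible⇒τ-hits1 (rec (rewriteAt [] (v ∷ʳ ▷) (inj₂ (inj₂ ◁0₃)))) (inj₁ 1₂ ∷ es)
... | ternary {v = v} 1₃ es refl =
  accessible⇒τ-hits1 (rec (rewriteAt [] (v ∷ʳ ▷) (inj₂ (inj₂ ◁1₃)))) (inj₁ 0₂ ∷ inj₁ 0₂ ∷ es)
... | ternary {v = v} 2₃ es refl =
  accessible⇒τ-hits1 (rec (rewriteAt [] (v ∷ʳ ▷) (inj₂ (inj₂ ◁2₃)))) (inj₁ 0₂ ∷ inj₁ 1₂ ∷ es)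
... | reduces {w′} es step value
  with accessible⇒τ-hits1 (rec (Rewrite-∷ ◁ step)) es | value 1
...   | hits | inj₁ same = subst (Hits1 τ) same hits
...   | hits | inj₂ τ-image = Hits1-step _ τ-image hits

stronglyNormalizing⇒τ-reaches1 : StronglyNormalizing (Rewrite T) → EveryTrajectoryReaches1 τ
stronglyNormalizing⇒τ-reaches1 sn n with binaryExpansion n
... | w , ds , refl = accessible⇒τ-hits1 (sn ⟨ w ⟩) ds

-- Termination of A and B

-- Doubling after a successor exceeds doubling before it, so moving ternary digits left lowers the
-- weight.
grow : ℕ → Symbol → ℕ
grow x 0₂ = 1 + x
grow x 1₂ = 1 + x
grow x 0₃ = 2 * x
grow x 1₃ = 2 * x
grow x 2₃ = 2 * x
-- A constant would not be strictly monotone. The summand 3 is the least for which doubling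
-- outweighs two new binary digits even at `x = 0`.
grow x ◁  = 3 + x
grow x ▷  = x

weigh : ℕ → List Symbol → ℕ
weigh = foldl grow

grow-mono-< : ∀ c {x y} → x < y → grow x c < grow y c
grow-mono-< 0₂ = s<s
grow-mono-< 1₂ = s<s
grow-mono-< 0₃ = *-monoʳ-< 2
grow-mono-< 1₃ = *-monoʳ-< 2
grow-mono-< 2₃ = *-monoʳ-< 2
grow-mono-< ◁  = +-monoʳ-< 3
grow-mono-< ▷  = λ x<y → x<y

weigh-mono-< : ∀ w {x y} → x < y → weigh x w < weigh y w
weigh-mono-< []      = λ x<y → x<y
weigh-mono-< (c ∷ w) = weigh-mono-< w ∘ grow-mono-< c

1+2x<2[1+x] : ∀ x → 1 + 2 * x < 2 * (1 + x)
1+2x<2[1+x] x = ≤-reflexive (sym (*-suc 2 x))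

2+[3+x]<2[3+x] : ∀ x → 2 + (3 + x) < 2 * (3 + x)
2+[3+x]<2[3+x] x = begin-strict
  2 + (3 + x)      <⟨ +-monoˡ-< (3 + x) (m≤m+n 3 x) ⟩
  3 + x + (3 + x)  ≡⟨ cong (3 + x +_) (+-identityʳ (3 + x)) ⟨
  2 * (3 + x)      ∎
  where open ≤-Reasoning

A∪B-weigh : ∀ {l r} → (A ∪ B) l r → ∀ x → weigh x r < weigh x l
A∪B-weigh (inj₁ 0₂0₃) x = 1+2x<2[1+x] x
A∪B-weigh (inj₁ 0₂1₃) x = 1+2x<2[1+x] x
A∪B-weigh (inj₁ 0₂2₃) x = 1+2x<2[1+x] x
A∪B-weigh (inj₁ 1₂0₃) x = 1+2x<2[1+x] x
A∪B-weigh (inj₁ 1₂1₃) x = 1+2x<2[1+x] x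
A∪B-weigh (inj₁ 1₂2₃) x = 1+2x<2[1+x] x
A∪B-weigh (inj₂ ◁0₃)  x = <-trans (n<1+n _) (2+[3+x]<2[3+x] x)
A∪B-weigh (inj₂ ◁1₃)  x = 2+[3+x]<2[3+x] x
A∪B-weigh (inj₂ ◁2₃)  x = 2+[3+x]<2[3+x] x

weigh-context : ∀ u {l r} v → (∀ x → weigh x r < weigh x l) →
                ∀ x → weigh x (u ++ r ++ v) < weigh x (u ++ l ++ v)
weigh-context u {l} {r} v weigh-< x
  rewrite foldl-++ grow x u (r ++ v) | foldl-++ grow x u (l ++ v)
        | foldl-++ grow (weigh x u) r v | foldl-++ grow (weigh x u) l v
  = weigh-mono-< v (weigh-< (weigh x u))

-- The Collatz conjecture implies termination of T

data State : Set where
  -- the number of binary digits read since the last ▷, no ◁ intervening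
  loose    : ℕ → State
  -- the value of the digits read since the last ◁
  anchored : (n : ℕ) → .{{NonZero n}} → State

read : State → Symbol → State
read _            ◁  = anchored 1
read _            ▷  = loose 0
read (loose b)    0₂ = loose (suc b)
read (loose b)    1₂ = loose (suc b)
-- Without `◁` no rule creates binary digits: A keeps their number and D_T consumes one, so ternary
-- digits need no count.
read (loose b)    _  = loose b
read (anchored n) c  = anchored (n ⊙ c) {{⊙-nonZero n c}}

run : State → List Symbol → State
run = foldl read

anchored-cong : ∀ {m n} .{p : NonZero m} .{q : NonZero n} → m ≡ n →
                anchored m {{p}} ≡ anchored n {{q}}
anchored-cong refl = refl

A-run : ∀ {l r} → A l r → ∀ s → run s l ≡ run s r
A-run 0₂0₃ (loose b) = refl
A-run 0₂1₃ (loose b) = refl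
A-run 0₂2₃ (loose b) = refl
A-run 1₂0₃ (loose b) = refl
A-run 1₂1₃ (loose b) = refl
A-run 1₂2₃ (loose b) = refl
A-run 0₂0₃ (anchored n) = anchored-cong (A-eval 0₂0₃ n)
A-run 0₂1₃ (anchored n) = anchored-cong (A-eval 0₂1₃ n)
A-run 0₂2₃ (anchored n) = anchored-cong (A-eval 0₂2₃ n)
A-run 1₂0₃ (anchored n) = anchored-cong (A-eval 1₂0₃ n)
A-run 1₂1₃ (anchored n) = anchored-cong (A-eval 1₂1₃ n)
A-run 1₂2₃ (anchored n) = anchored-cong (A-eval 1₂2₃ n)

A∪B-run : ∀ {l r} → (A ∪ B) l r → ∀ s → run s l ≡ run s r
A∪B-run (inj₁ rule) s = A-run rule s
A∪B-run (inj₂ ◁0₃)  s = refl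
A∪B-run (inj₂ ◁1₃)  s = refl
A∪B-run (inj₂ ◁2₃)  s = refl

-- `▷` resets the state, which hides the changed value from everything to its right.
D-T-run : ∀ {l r} → D-T l r → ∀ s → run s l ≡ run s r
D-T-run 0₂▷ s = refl
D-T-run 1₂▷ s = refl

module _ (reaches : EveryTrajectoryReaches1 τ) where

  cost : State → ℕ
  cost (loose b)    = b
  cost (anchored n) = stoppingTime τ reaches n

  toll : State → Symbol → ℕ
  toll s ▷ = cost s
  toll s _ = 0

  charge : State → List Symbol → ℕ
  charge s []      = 0
  charge s (c ∷ w) = toll s c + charge (read s c) w

  charge-++ : ∀ s u v → charge s (u ++ v) ≡ charge s u + charge (run s u) v
  charge-++ s []      v = refl
  charge-++ s (c ∷ u) v = trans (cong (toll s c +_) (charge-++ (read s c) u v))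
                                (sym (+-assoc (toll s c) _ _))

  -- No `▷` occurs in these rules, so neither side pays a toll.
  A∪B-charge : ∀ {l r} → (A ∪ B) l r → ∀ s → charge s r ≡ charge s l
  A∪B-charge (inj₁ 0₂0₃) s = refl
  A∪B-charge (inj₁ 0₂1₃) s = refl
  A∪B-charge (inj₁ 0₂2₃) s = refl
  A∪B-charge (inj₁ 1₂0₃) s = refl
  A∪B-charge (inj₁ 1₂1₃) s = refl
  A∪B-charge (inj₁ 1₂2₃) s = refl
  A∪B-charge (inj₂ ◁0₃)  s = refl
  A∪B-charge (inj₂ ◁1₃)  s = refl
  A∪B-charge (inj₂ ◁2₃)  s = refl

  D-T-charge : ∀ {l r} → D-T l r → ∀ s → charge s r < charge s l
  D-T-charge 0₂▷ (loose b) = n<1+n (b + 0)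
  D-T-charge 1₂▷ (loose b) = n<1+n (b + 0)
  D-T-charge 0₂▷ (anchored n) = +-monoˡ-< 0
    (stoppingTime-< τ reaches n (2 * n) {{_}} {{⊙-nonZero n 0₂}} (τ-even n) (even≢odd n 0))
  -- Positivity of `n` keeps `1 + 2 * n` away from 1, where the stopping time is 0 and cannot drop.
  D-T-charge 1₂▷ (anchored n@(suc _)) = +-monoˡ-< 0
    (stoppingTime-< τ reaches (2 + 3 * n) (1 + 2 * n) (τ-odd n) λ ())

  -- The charge comes first because `1₂▷` can increase the weight, replacing a successor by a
  -- doubling.
  measure : List Symbol → ℕ × ℕ
  measure w = charge (loose 0) w , weigh 0 w

  _≺_ : ℕ × ℕ → ℕ × ℕ → Set
  _≺_ = ×-Lex _≡_ _<_ _<_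

  module _ (_∼_ : ℕ → ℕ → Set) (∼-+ˡ : ∀ k {m n} → m ∼ n → (k + m) ∼ (k + n))
           (∼-+ʳ : ∀ k {m n} → m ∼ n → (m + k) ∼ (n + k)) where

    -- Equal runs make `v` start in the same state and cost the same. The relation is abstract to
    -- serve both the strict drop for D_T and the invariance for A and B.
    charge-context : ∀ u {l r} v → (∀ s → run s l ≡ run s r) →
                     (∀ s → charge s r ∼ charge s l) →
                     ∀ s → charge s (u ++ r ++ v) ∼ charge s (u ++ l ++ v)
    charge-context u {l} {r} v run-eq charge-∼ s
      rewrite charge-++ s u (r ++ v) | charge-++ s u (l ++ v)
            | charge-++ (run s u) r v | charge-++ (run s u) l v
            | run-eq (run s u)
      = ∼-+ˡ (charge s u) (∼-+ʳ _ (charge-∼ (run s u)))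

  measure-decreases : ∀ {x y} → Rewrite T x y → measure y ≺ measure x
  measure-decreases (rewriteAt u v (inj₁ rule)) = inj₁
    (charge-context _<_ +-monoʳ-< (λ k → +-monoˡ-< k) u v
      (D-T-run rule) (D-T-charge rule) (loose 0))
  measure-decreases (rewriteAt u v (inj₂ rule)) = inj₂
    ( charge-context _≡_ (λ k → cong (k +_)) (λ k → cong (_+ k)) u v
        (A∪B-run rule) (A∪B-charge rule) (loose 0)
    , weigh-context u v (A∪B-weigh rule) 0)

  τ-reaches1⇒stronglyNormalizing : StronglyNormalizing (Rewrite T)
  τ-reaches1⇒stronglyNormalizing =
    Subrelation.wellFounded {_<₂_ = _≺_ on measure} measure-decreases
      (On.wellFounded measure (×-wellFounded <-wellFounded <-wellFounded))

-- Only the step from the absence of infinite sequences to accessibility is classical, so excluded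
-- middle is confined to the first component.
mainTheorem6 : (ExcludedMiddle 0ℓ → Terminating T ⇔ CollatzConjecture)
    × (StronglyNormalizing (Rewrite T) ⇔ CollatzConjecture)
    × (CollatzConjecture ⇔ EveryTrajectoryReaches1 τ)
mainTheorem6 =
    (λ em → ⇔-trans (mk⇔ (terminating⇒stronglyNormalizing em) stronglyNormalizing⇒terminating)
                    sn⇔collatz)
  , sn⇔collatz
  , collatz⇔τ-reaches1
  where
  sn⇔collatz : StronglyNormalizing (Rewrite T) ⇔ CollatzConjecture
  sn⇔collatz = ⇔-trans (mk⇔ stronglyNormalizing⇒τ-reaches1 τ-reaches1⇒stronglyNormalizing)
                       (⇔-sym collatz⇔τ-reaches1)
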